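{- Let $(\Gamma,<)$ be an ordered set and let $\Delta \subsetneq \Gamma$ be a non-trivial (i.e. non-empty) proper $\mathcal{L}_<$-definable final segment. Assume that $\Gamma$ is dense or discrete. Then there is $\gamma \in \Gamma$ such that $\Delta = \gamma_-$ or $\Delta = \gamma_+$.
   Context: All orderings are linear. $\mathcal{L}_<=\{<\}$ is the language of ordered sets, and "definable" means first-order definable with parameters from the structure. A final segment of $\Gamma$ is a subset $\Delta$ such that $a\in\Delta$, $b\in\Gamma$, $a<b$ imply $b\in\Delta$. An element $b$ is the successor of $a$ (and $a$ the predecessor of $b$) if $a<b$ and there is no $c$ with $a<c<b$. $(\Gamma,<)$ is dense if no element has a successor; it is discrete if for any $a<b$ in $\Gamma$ there exist a successor of $a$ and a predecessor of $b$. For $\gamma\in\Gamma$: $\gamma_-:=\{i\in\Gamma\mid \gamma\le i\}$ and $\gamma_+:=\{i\in\Gamma\mid\gamma<i\}$. -}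

module Defs where

open import Data.Empty.Polymorphic using (⊥)
open import Data.Fin.Base using (Fin)
open import Data.Nat.Base using (ℕ; suc)
open import Data.Product.Base using (Σ-syntax; ∃-syntax; _×_)
open import Data.Sum.Base using (_⊎_)
open import Data.Vec.Base using (Vec; _∷_; lookup)
open import Function.Bundles using (_⇔_)
open import Level using (Level; _⊔_; Lift)
open import Relation.Binary.Bundles using (StrictTotalOrder)
import Relation.Binary.Construct.StrictToNonStrict as StrictToNonStrict
open import Relation.Nullary.Negation.Core using (¬_)
open import Relation.Unary using (Pred; _∈_)

infix  8 _≺̇_ _≈̇_
infixr 7 _∧̇_
infixr 6 _∨̇_
infixr 5 _⇒̇_

-- First-order formulas over {<} with equality, with free variables among
-- n de Bruijn indices.  The language has no function symbols, so terms are
-- variables; negation is φ ⇒̇ ⊥̇.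
data Formula (n : ℕ) : Set where
  _≺̇_ _≈̇_         : (i j : Fin n) → Formula n
  ⊥̇               : Formula n
  _∧̇_ _∨̇_ _⇒̇_     : (φ ψ : Formula n) → Formula n
  ∀̇_ ∃̇_           : (φ : Formula (suc n)) → Formula n

module Ordered {c ℓ₁ ℓ₂ : Level} (Γ : StrictTotalOrder c ℓ₁ ℓ₂) where

  open StrictTotalOrder Γ using (Carrier; _≈_; _<_)
  open StrictToNonStrict _≈_ _<_ using (_≤_)

  infix 4 _⊨_

  _⊨_ : ∀ {n} → Vec Carrier n → Formula n → Set (c ⊔ ℓ₁ ⊔ ℓ₂)
  ρ ⊨ i ≺̇ j  = Lift (c ⊔ ℓ₁) (lookup ρ i < lookup ρ j)
  ρ ⊨ i ≈̇ j  = Lift (c ⊔ ℓ₂) (lookup ρ i ≈ lookup ρ j)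
  ρ ⊨ ⊥̇      = ⊥
  ρ ⊨ φ ∧̇ ψ  = (ρ ⊨ φ) × (ρ ⊨ ψ)
  ρ ⊨ φ ∨̇ ψ  = (ρ ⊨ φ) ⊎ (ρ ⊨ ψ)
  ρ ⊨ φ ⇒̇ ψ  = (ρ ⊨ φ) → (ρ ⊨ ψ)
  ρ ⊨ (∀̇ φ)  = ∀ x → x ∷ ρ ⊨ φ
  ρ ⊨ (∃̇ φ)  = ∃[ x ] (x ∷ ρ ⊨ φ)

  -- Variable 0 is the element being tested; the others are the parameters.
  Definable : ∀ {ℓ} → Pred Carrier ℓ → Set (c ⊔ ℓ₁ ⊔ ℓ₂ ⊔ ℓ)
  Definable Δ =
    ∃[ n ] Σ[ φ ∈ Formula (suc n) ] Σ[ params ∈ Vec Carrier n ]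
      (∀ x → x ∈ Δ ⇔ (x ∷ params ⊨ φ))

  FinalSegment : ∀ {ℓ} → Pred Carrier ℓ → Set (c ⊔ ℓ₂ ⊔ ℓ)
  FinalSegment Δ = ∀ {a b} → a ∈ Δ → a < b → b ∈ Δ

  _IsSuccessorOf_ : Carrier → Carrier → Set (c ⊔ ℓ₂)
  b IsSuccessorOf a = a < b × ¬ (∃[ x ] (a < x × x < b))

  _IsPredecessorOf_ : Carrier → Carrier → Set (c ⊔ ℓ₂)
  a IsPredecessorOf b = b IsSuccessorOf a

  Dense : Set (c ⊔ ℓ₂)
  Dense = ∀ a → ¬ (∃[ b ] b IsSuccessorOf a)

  Discrete : Set (c ⊔ ℓ₂)
  Discrete = ∀ {a b} → a < b →
    (∃[ s ] s IsSuccessorOf a) × (∃[ p ] p IsPredecessorOf b)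

  _₋ : Carrier → Pred Carrier (ℓ₁ ⊔ ℓ₂)
  (γ ₋) i = γ ≤ i

  _₊ : Carrier → Pred Carrier ℓ₂
  (γ ₊) i = γ < i

{-# OPTIONS --safe #-}
-- The proof is an Ehrenfeucht–Fraïssé argument.  If Δ has no first element and
-- its complement has no last one, then around the cut there is room on both
-- sides.  Two convex sets look alike in the k-round game as soon as they have
-- the same number of elements up to 2^(k+1) − 1 and agree on having a first and
-- a last element: in a dense or discrete order this similarity survives
-- splitting the sets at suitable points.  Hence a point x just below the cut and
-- a point y just above it, both far from the parameters and the ends, satisfy
-- the same formulas of rank k over the parameters, so no formula separates Δ
-- from its complement.
module Submission where

open import Defs
open import Axiom.ExcludedMiddle using (ExcludedMiddle)
open import Data.Empty using (⊥-elim)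
open import Data.Fin.Base using (zero; suc)
open import Data.Nat.Base using (ℕ; zero; suc; _+_; _≤_; z≤n; s≤s) renaming (_⊔_ to _⊔ℕ_)
open import Data.Nat.Properties
  using (≤-refl; ≤-trans; m≤m+n; m≤n+m; n≤1+n; +-suc; +-comm;
         +-monoˡ-≤; +-monoʳ-≤; m⊔n≤o⇒m≤o; m⊔n≤o⇒n≤o; ≰⇒>; _≤?_)
open import Data.Product.Base using (∃-syntax; Σ-syntax; _×_; _,_; proj₁; proj₂; swap)
open import Data.Sum.Base using (_⊎_; inj₁; inj₂)
open import Data.Unit.Polymorphic using (⊤)
open import Data.Vec.Base using (Vec; []; _∷_; lookup)
open import Function.Bundles using (module Equivalence)
open import Level using (Level; _⊔_; lift)
open import Relation.Binary.Bundles using (StrictTotalOrder)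
open import Relation.Binary.Definitions using (tri<; tri≈; tri>)
import Relation.Binary.Construct.Flip.EqAndOrd as Flip
open import Relation.Binary.PropositionalEquality using (subst)
open import Relation.Nullary using (¬_; yes; no)
open import Relation.Unary using (Pred; Satisfiable; U; _⊂_; _⊆_; _≐_)

private variable
  k m n : ℕ

-- Convex sets and their end points

module Counting {c ℓ₁ ℓ₂ : Level} (em : ExcludedMiddle (c ⊔ ℓ₁ ⊔ ℓ₂))
                (Γ : StrictTotalOrder c ℓ₁ ℓ₂) where

  open StrictTotalOrder Γ
    using (Carrier; _≈_; _<_; compare; trans; irrefl; <-respʳ-≈; <-respˡ-≈; module Eq)

  Subset : Set _
  Subset = Pred Carrier (c ⊔ ℓ₁ ⊔ ℓ₂)

  private variable
    I J : Subset
    x y z : Carrier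

  infixl 20 _↓_ _↑_

  _↓_ _↑_ : Subset → Carrier → Subset
  (I ↓ x) y = I y × y < x
  (I ↑ x) y = I y × x < y

  asym : x < y → ¬ y < x
  asym x<y y<x = irrefl Eq.refl (trans x<y y<x)

  ≮-<-trans : ¬ y < x → y < z → x < z
  ≮-<-trans {y} {x} y≮x y<z with compare x y
  ... | tri< x<y _ _ = trans x<y y<z
  ... | tri≈ _ x≈y _ = <-respˡ-≈ (Eq.sym x≈y) y<z
  ... | tri> _ _ y<x = ⊥-elim (y≮x y<x)

  <-≮-trans : x < y → ¬ z < y → x < z
  <-≮-trans {y = y} {z = z} x<y z≮y with compare y z
  ... | tri< y<z _ _ = trans x<y y<z
  ... | tri≈ _ y≈z _ = <-respʳ-≈ y≈z x<y
  ... | tri> _ _ z<y = ⊥-elim (z≮y z<y)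

  -- The bounds are negated strict inequalities, so the case a = b already closes a convex set under
  -- `≈`.
  Convex : Subset → Set _
  Convex I = ∀ {a b x} → I a → I b → ¬ x < a → ¬ b < x → I x

  ↓-convex : Convex I → Convex (I ↓ x)
  ↓-convex conv (Ia , _) (Ib , b<x) z≮a b≮z = conv Ia Ib z≮a b≮z , ≮-<-trans b≮z b<x

  ↑-convex : Convex I → Convex (I ↑ x)
  ↑-convex conv (Ia , x<a) (Ib , _) z≮a b≮z = conv Ia Ib z≮a b≮z , <-≮-trans x<a z≮a

  convex-resp : Convex I → x ≈ y → I x → I y
  convex-resp conv x≈y Ix =
    conv Ix Ix (irrefl (Eq.sym x≈y)) (irrefl x≈y)

  HasFirst HasLast : Subset → Set _
  HasFirst I = ∃[ x ] (I x × (∀ {y} → I y → ¬ y < x))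
  HasLast  I = ∃[ x ] (I x × (∀ {y} → I y → ¬ x < y))

  Adjacent : Carrier → Carrier → Set _
  Adjacent a b = a < b × (∀ {x} → a < x → ¬ x < b)

  -- The only consequence of "dense or discrete" that the proof needs.
  Homogeneous : Set _
  Homogeneous = ∀ {a b c d} → Adjacent a b → c < d →
    (∃[ s ] Adjacent c s) × (∃[ p ] Adjacent p d)

  -- Counting by increasing chains

  infixr 5 _∷_

  -- A strictly increasing chain listed from the bottom: the tail is drawn from the points above the
  -- head. Upper bounds on size are negations of it.
  data AtLeast (I : Subset) : ℕ → Set (c ⊔ ℓ₁ ⊔ ℓ₂) where
    []  : AtLeast I 0
    _∷_ : I x → AtLeast (I ↑ x) m → AtLeast I (suc m)

  mono : I ⊆ J → m ≤ n → AtLeast I n → AtLeast J m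
  mono I⊆J z≤n       _        = []
  mono I⊆J (s≤s m≤n) (Ix ∷ a) = I⊆J Ix ∷ mono (λ (Iy , x<y) → I⊆J Iy , x<y) m≤n a

  join : I x → AtLeast (I ↓ x) m → AtLeast (I ↑ x) n → AtLeast I (m + suc n)
  join Ix [] b = Ix ∷ b
  join Ix ((Iz , z<x) ∷ a) b = Iz ∷ join (Ix , z<x)
    (mono (λ ((Iy , y<x) , z<y) → (Iy , z<y) , y<x) ≤-refl a)
    (mono (λ (Iy , x<y) → (Iy , trans z<x x<y) , x<y) ≤-refl b)

  -- If the first m points of the chain are not all below x, the first one at or above x has at
  -- least n points after it, all above x.
  divide : ∀ m → AtLeast I (m + n) → ∀ x → AtLeast (I ↓ x) m ⊎ AtLeast (I ↑ x) n
  divide zero a x = inj₁ []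
  divide (suc m) (_∷_ {x = z} Iz a) x with compare z x
  ... | tri≈ _ z≈x _ = inj₂ (mono (λ (Iy , z<y) → Iy , <-respˡ-≈ z≈x z<y) (m≤n+m _ m) a)
  ... | tri> _ _ x<z = inj₂ (mono (λ (Iy , z<y) → Iy , trans x<z z<y) (m≤n+m _ m) a)
  ... | tri< z<x _ _ with divide m a x
  ...   | inj₁ b = inj₁ ((Iz , z<x) ∷ mono (λ ((Iy , z<y) , y<x) → (Iy , y<x) , z<y) ≤-refl b)
  ...   | inj₂ b = inj₂ (mono (λ ((Iy , _) , x<y) → Iy , x<y) ≤-refl b)

  pick : ∀ m → AtLeast I (m + suc n) → ∃[ x ] (I x × AtLeast (I ↓ x) m × AtLeast (I ↑ x) n)
  pick zero    (Ix ∷ a) = _ , Ix , [] , a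
  pick (suc m) (Iz ∷ a) with pick m a
  ... | x , (Ix , z<x) , b , d = x , Ix ,
    (Iz , z<x) ∷ mono (λ ((Iy , z<y) , y<x) → (Iy , y<x) , z<y) ≤-refl b ,
    mono (λ ((Iy , _) , x<y) → Iy , x<y) ≤-refl d

  unsnoc : AtLeast I (suc m) → ∃[ x ] (I x × AtLeast (I ↓ x) m)
  unsnoc {I = I} {m = m} a with pick m (subst (AtLeast I) (+-comm 1 m) a)
  ... | x , Ix , b , _ = x , Ix , b

  ¬last⇒AtLeast : (∀ {x} → I x → ∃[ y ] (I y × x < y)) → I x → ∀ m → AtLeast I m
  ¬last⇒AtLeast next Ix zero = []
  ¬last⇒AtLeast next Ix (suc m) = Ix ∷ ¬last⇒AtLeast
    (λ (Iy , x<y) → let z , Iz , y<z = next Iy in z , (Iz , trans x<y y<z) , y<z)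
    (proj₂ (next Ix)) m

  -- Each step to a larger element shortens the chains still possible, so the climb stops within the
  -- bound m.
  finite⇒HasLast : I x → ∀ m → ¬ AtLeast I m → HasLast I
  finite⇒HasLast Ix zero ¬a = ⊥-elim (¬a [])
  finite⇒HasLast {I} {x} Ix (suc m) ¬a with em {∃[ y ] (I ↑ x) y}
  ... | no ¬y = x , Ix , λ Iy x<y → ¬y (_ , Iy , x<y)
  ... | yes (y , Iy) with finite⇒HasLast Iy m (λ a → ¬a (Ix ∷ a))
  ...   | z , (Iz , x<z) , last = z , Iz , λ Iw z<w → last (Iw , trans x<z z<w) z<w

  last-adjacent : Convex I → I x → ((z , _) : HasLast (I ↓ x)) → Adjacent z x
  last-adjacent conv Ix (z , (Iz , z<x) , last) =
    z<x , λ z<v v<x → last (conv Iz Ix (asym z<v) (asym v<x) , v<x) z<v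

  exact-count : ∀ n → ¬ AtLeast I n → ∃[ m ] (suc m ≤ n × AtLeast I m × ¬ AtLeast I (suc m))
  exact-count zero ¬a = ⊥-elim (¬a [])
  exact-count {I} (suc n) ¬a with em {AtLeast I n}
  ... | yes a = n , ≤-refl , a , ¬a
  ... | no ¬b with exact-count n ¬b
  ...   | m , m<n , rest = m , ≤-trans m<n (n≤1+n n) , rest

  -- Walks up J by successors from its first element. When n is positive, the last point of I below
  -- x forms an adjacent pair with x, and homogeneity turns this pair into the successor needed in
  -- J.
  same-position : Homogeneous → Convex I → Convex J → (HasFirst I → HasFirst J) → ∀ n →
    AtLeast J (suc n) → I x → AtLeast (I ↓ x) n → ¬ AtLeast (I ↓ x) (suc n) →
    ∃[ y ] (J y × AtLeast (J ↓ y) n × ¬ AtLeast (J ↓ y) (suc n))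
  same-position hom convI convJ first zero _ Ix _ ¬a
    with first (_ , Ix , λ Iz z<x → ¬a ((Iz , z<x) ∷ []))
  ... | y , Jy , least = y , Jy , [] , λ where ((Jz , z<y) ∷ _) → least Jz z<y
  same-position {I} {J} {x} hom convI convJ first (suc n) j Ix a@(Iv ∷ _) ¬a
    with finite⇒HasLast Iv (suc (suc n)) ¬a
  ... | hasLast@(w , (Iw , w<x) , last) with same-position hom convI convJ first n
          (mono (λ Jy → Jy) (n≤1+n _) j) Iw below-w not-below-w
    where
    below-w : AtLeast (I ↓ w) n
    below-w with divide n (subst (AtLeast (I ↓ x)) (+-comm 1 n) a) w
    ... | inj₁ b = mono (λ ((Iy , _) , y<w) → Iy , y<w) ≤-refl b
    ... | inj₂ ((Iy , w<y) ∷ _) = ⊥-elim (last Iy w<y)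
    not-below-w : ¬ AtLeast (I ↓ w) (suc n)
    not-below-w b = ¬a (subst (AtLeast (I ↓ x)) (+-comm (suc n) 1) (join (Iw , w<x)
      (mono (λ (Iy , y<w) → (Iy , trans y<w w<x) , y<w) ≤-refl b) []))
  ...   | y , Jy , below-y , not-below-y
    -- J has n + 2 points and y has exactly n below it, so some z in J lies above y; convexity then
    -- keeps the successor s of y inside J.
    with divide (suc n) (subst (AtLeast J) (+-comm 1 (suc n)) j) y
  ...     | inj₁ b = ⊥-elim (not-below-y b)
  ...     | inj₂ ((Jz , y<z) ∷ _) with proj₁ (hom (last-adjacent convI Ix hasLast) y<z)
  ...       | s , y<s , adj = s , convJ Jy Jz (asym y<s) (adj y<z) , below-s , not-below-s
    where
    below-s : AtLeast (J ↓ s) (suc n)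
    below-s = subst (AtLeast (J ↓ s)) (+-comm n 1) (join (Jy , y<s)
      (mono (λ (Jv , v<y) → (Jv , trans v<y y<s) , v<y) ≤-refl below-y) [])
    not-below-s : ¬ AtLeast (J ↓ s) (suc (suc n))
    not-below-s b with divide (suc n) (subst (AtLeast (J ↓ s)) (+-comm 1 (suc n)) b) y
    ... | inj₁ d = not-below-y (mono (λ ((Jv , _) , v<y) → Jv , v<y) ≤-refl d)
    ... | inj₂ (((_ , v<s) , y<v) ∷ _) = adj y<v v<s

  -- Similarity of convex sets and answers near the lower end

  Counts : ℕ → Subset → Subset → Set _
  Counts n I J = ∀ {m} → m ≤ n → AtLeast I m → AtLeast J m

  record _≲[_]_ (I : Subset) (n : ℕ) (J : Subset) : Set (c ⊔ ℓ₁ ⊔ ℓ₂) where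
    constructor similar
    field
      counts : Counts n I J
      first  : HasFirst I → HasFirst J
      last   : HasLast I → HasLast J
  open _≲[_]_ public

  infix 4 _≲[_]_ _≋[_]_

  _≋[_]_ : Subset → ℕ → Subset → Set _
  I ≋[ n ] J = (I ≲[ n ] J) × (J ≲[ n ] I)

  ≲-refl : I ≲[ n ] I
  ≲-refl = similar (λ _ a → a) (λ f → f) (λ l → l)

  ≲-weaken : m ≤ n → I ≲[ n ] J → I ≲[ m ] J
  ≲-weaken m≤n (similar cs f l) = similar (λ p → cs (≤-trans p m≤n)) f l

  -- A first element comes from that of the whole set: `1 ≤ n` carries non-emptiness over to J ↓ y,
  -- so the first element of J lies below y. A last element of I ↓ x is adjacent to x, so
  -- homogeneity gives y a predecessor.
  ↓-≲ : Homogeneous → Convex I → Convex J → I ≲[ m ] J → I x → J y →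
    1 ≤ n → Counts n (I ↓ x) (J ↓ y) → (I ↓ x) ≲[ n ] (J ↓ y)
  ↓-≲ {I} {J} {x = x} {y = y} hom convI convJ I≲J Ix Jy 1≤n cs = similar cs first↓ last↓
    where
    first↓ : HasFirst (I ↓ x) → HasFirst (J ↓ y)
    first↓ (z , (Iz , z<x) , least)
      with first I≲J (z , Iz , λ Iv v<z → least (Iv , trans v<z z<x) v<z)
         | cs 1≤n ((Iz , z<x) ∷ [])
    ... | f , Jf , leastJ | (Jw , w<y) ∷ _ =
      f , (Jf , ≮-<-trans (leastJ Jw) w<y) , λ (Jv , _) → leastJ Jv
    last↓ : HasLast (I ↓ x) → HasLast (J ↓ y)
    last↓ hasLast@(z , Iz , _) with cs 1≤n (Iz ∷ [])
    ... | (Jw , w<y) ∷ _ with proj₂ (hom (last-adjacent convI Ix hasLast) w<y)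
    ...   | p , p<y , adj =
      p , (convJ Jw Jy (λ p<w → adj p<w w<y) (asym p<y) , p<y) , λ (_ , v<y) p<v → adj p<v v<y

  -- With l points above x, I has n + 1 + l points, hence so does J; at most n of these are below y
  -- and one may be y itself, which leaves l above.
  counts-above : AtLeast (I ↓ x) n → I x → ¬ AtLeast (J ↓ y) (suc n) → suc n ≤ m →
    Counts (m + suc m) I J → Counts m (I ↑ x) (J ↑ y)
  counts-above {n = n} {J = J} {y = y} {m = m} a Ix ¬b n<m cs {l} l≤m d
    with divide (suc n) (subst (AtLeast J) (+-suc n l) (cs bound (join Ix a d))) y
    where
    bound : n + suc l ≤ m + suc m
    bound = ≤-trans (+-monoˡ-≤ (suc l) (≤-trans (n≤1+n n) n<m)) (+-monoʳ-≤ m (s≤s l≤m))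
  ... | inj₁ b = ⊥-elim (¬b b)
  ... | inj₂ e = e

  counts-exact : AtLeast J n → ¬ AtLeast I (suc n) → Counts m I J
  counts-exact {n = n} b ¬a {l} _ a with l ≤? n
  ... | yes l≤n = mono (λ Jy → Jy) l≤n b
  ... | no  l≰n = ⊥-elim (¬a (mono (λ Iy → Iy) (≰⇒> l≰n) a))

  counts-full : AtLeast J n → Counts n I J
  counts-full b m≤n _ = mono (λ Jy → Jy) m≤n b

  Answer : ℕ → Subset → Subset → Carrier → Carrier → Set _
  Answer n I J x y = (Counts n (I ↓ x) (J ↓ y) × Counts n (J ↓ y) (I ↓ x)) ×
                     (Counts n (I ↑ x) (J ↑ y) × Counts n (J ↑ y) (I ↑ x))

  -- A point with fewer than n points below it is answered at exactly the same position in J;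
  -- `counts-above` then settles the other side.
  answer-low : Homogeneous → Convex I → Convex J → I ≋[ n + suc n ] J → I x →
    ¬ AtLeast (I ↓ x) n → ∃[ y ] (J y × Answer n I J x y)
  answer-low {n = n} hom convI convJ (I≲J , J≲I) Ix ¬a with exact-count n ¬a
  ... | m , m<n , a , ¬a⁺ with same-position hom convI convJ (first I≲J) m
          (counts I≲J (≤-trans m<n (m≤m+n n _))
            (subst (AtLeast _) (+-comm m 1) (join Ix a [])))
          Ix a ¬a⁺
  ...   | y , Jy , b , ¬b⁺ = y , Jy ,
    (counts-exact b ¬a⁺ , counts-exact a ¬b⁺) ,
    (counts-above a Ix ¬b⁺ m<n (counts I≲J) , counts-above b Jy ¬a⁺ m<n (counts J≲I))

-- Order reversal and the answer to an arbitrary move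

module Game {c ℓ₁ ℓ₂ : Level} (em : ExcludedMiddle (c ⊔ ℓ₁ ⊔ ℓ₂))
            (Γ : StrictTotalOrder c ℓ₁ ℓ₂) (hom : Counting.Homogeneous em Γ) where

  open StrictTotalOrder Γ
    using (Carrier; _≈_; _<_; compare; trans; irrefl; <-respʳ-≈; <-respˡ-≈; module Eq)
  open Ordered Γ using (_⊨_)
  open Counting em Γ
  -- The same results for the reversed order, where `↓` and `↑` trade places; they handle the upper
  -- side.
  private module Op = Counting em (Flip.strictTotalOrder Γ)

  private variable
    I J : Subset
    a b x y : Carrier

  homᵒ : Op.Homogeneous
  homᵒ (b<a , adj) d<c with hom (b<a , λ p q → adj q p) d<c
  ... | (s , c<s , adjs) , (p , p<d , adjp) =
    (p , p<d , λ u v → adjp v u) , (s , c<s , λ u v → adjs v u)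

  convexᵒ : Convex I → Op.Convex I
  convexᵒ conv Ia Ib x≮a b≮x = conv Ib Ia b≮x x≮a

  reverse : ∀ m → AtLeast I m → Op.AtLeast I m
  reverse zero    _ = Op.[]
  reverse (suc m) a with unsnoc a
  ... | _ , Ix , b = Ix Op.∷ reverse m b

  reverse⁻¹ : ∀ m → Op.AtLeast I m → AtLeast I m
  reverse⁻¹ zero    _ = []
  reverse⁻¹ (suc m) a with Op.unsnoc a
  ... | _ , Ix , b = Ix ∷ reverse⁻¹ m b

  countsᵒ : Counts n I J → Op.Counts n I J
  countsᵒ cs m≤n a = reverse _ (cs m≤n (reverse⁻¹ _ a))

  countsᵒ⁻¹ : Op.Counts n I J → Counts n I J
  countsᵒ⁻¹ cs m≤n a = reverse⁻¹ _ (cs m≤n (reverse _ a))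

  ≲ᵒ : I ≲[ n ] J → I Op.≲[ n ] J
  ≲ᵒ (similar cs f l) = Op.similar (countsᵒ cs) l f

  ≲ᵒ⁻¹ : I Op.≲[ n ] J → I ≲[ n ] J
  ≲ᵒ⁻¹ (Op.similar cs f l) = similar (countsᵒ⁻¹ cs) l f

  -- A point close to an end is answered by a point equally close to that end. Otherwise x has n
  -- points on each side, so J too has a chain of n + 1 + n points, and its middle serves.
  answer : Convex I → Convex J → I ≋[ n + suc n ] J → I x → ∃[ y ] (J y × Answer n I J x y)
  answer {I} {J} {n} {x} convI convJ I≋J@(I≲J , J≲I) Ix
    with em {AtLeast (I ↓ x) n} | em {AtLeast (I ↑ x) n}
  ... | no ¬a | _ = answer-low hom convI convJ I≋J Ix ¬a
  ... | yes _ | no ¬b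
    with Op.answer-low homᵒ (convexᵒ convI) (convexᵒ convJ) (≲ᵒ I≲J , ≲ᵒ J≲I) Ix
           (λ b → ¬b (reverse⁻¹ n b))
  ...   | y , Jy , (p , q) , (r , s) =
    y , Jy , (countsᵒ⁻¹ r , countsᵒ⁻¹ s) , (countsᵒ⁻¹ p , countsᵒ⁻¹ q)
  answer {n = n} _ _ (I≲J , _) Ix | yes a | yes b with pick n (counts I≲J ≤-refl (join Ix a b))
  ... | y , Jy , d , e =
    y , Jy , (counts-full d , counts-full a) , (counts-full e , counts-full b)

  split : Convex I → Convex J → I ≋[ m ] J → I x → J y → 1 ≤ n → Answer n I J x y →
    (I ↓ x ≋[ n ] J ↓ y) × (I ↑ x ≋[ n ] J ↑ y)
  split convI convJ (I≲J , J≲I) Ix Jy 1≤n ((p , q) , (r , s)) =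
    (↓-≲ hom convI convJ I≲J Ix Jy 1≤n p , ↓-≲ hom convJ convI J≲I Jy Ix 1≤n q) ,
    (↑-≲ convI convJ I≲J Ix Jy r , ↑-≲ convJ convI J≲I Jy Ix s)
    where
    ↑-≲ : ∀ {I J x y} → Convex I → Convex J → I ≲[ _ ] J → I x → J y →
      Counts _ (I ↑ x) (J ↑ y) → (I ↑ x) ≲[ _ ] (J ↑ y)
    ↑-≲ convI convJ I≲J Ix Jy cs = ≲ᵒ⁻¹
      (Op.↓-≲ homᵒ (convexᵒ convI) (convexᵒ convJ) (≲ᵒ I≲J) Ix Jy 1≤n (countsᵒ cs))

  -- Positions of the game

  size : ℕ → ℕ
  -- Starting at 1 keeps the emptiness of every gap visible, as `split` requires; the recursion
  -- leaves room for `size k` points on each side of a new point.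
  size zero    = 1
  size (suc k) = size k + suc (size k)

  1≤size : ∀ k → 1 ≤ size k
  1≤size zero    = ≤-refl
  1≤size (suc k) = ≤-trans (1≤size k) (m≤m+n _ _)

  -- A position of the game, as a search tree whose nodes are the pairs of points
  -- already chosen and whose leaves are the gaps left between them.
  data Position (k : ℕ) (I J : Subset) : Set (c ⊔ ℓ₁ ⊔ ℓ₂) where
    gap  : I ≋[ size k ] J → Position k I J
    node : I x → J y → Position k (I ↓ x) (J ↓ y) → Position k (I ↑ x) (J ↑ y) → Position k I J

  data Chosen {k : ℕ} {I J : Subset} (a b : Carrier) :
              Position k I J → Set (c ⊔ ℓ₁ ⊔ ℓ₂) where
    here  : ∀ {Ix : I x} {Jy : J y} {s t} → a ≈ x → b ≈ y → Chosen a b (node Ix Jy s t)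
    left  : ∀ {Ix : I x} {Jy : J y} {s t} → Chosen a b s → Chosen a b (node Ix Jy s t)
    right : ∀ {Ix : I x} {Jy : J y} {s t} → Chosen a b t → Chosen a b (node Ix Jy s t)

  chosen∈ : Convex I → Convex J → {t : Position k I J} → Chosen a b t → I a × J b
  chosen∈ convI convJ (here {Ix = Ix} {Jy = Jy} a≈x b≈y) =
    convex-resp convI (Eq.sym a≈x) Ix , convex-resp convJ (Eq.sym b≈y) Jy
  chosen∈ convI convJ (left p) with chosen∈ (↓-convex convI) (↓-convex convJ) p
  ... | (Ia , _) , (Jb , _) = Ia , Jb
  chosen∈ convI convJ (right p) with chosen∈ (↑-convex convI) (↑-convex convJ) p
  ... | (Ia , _) , (Jb , _) = Ia , Jb

  chosen-respʳ : ∀ {a b b′} {t : Position k I J} → b ≈ b′ → Chosen a b t → Chosen a b′ t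
  chosen-respʳ b≈b′ (here p q) = here p (Eq.trans (Eq.sym b≈b′) q)
  chosen-respʳ b≈b′ (left u)   = left (chosen-respʳ b≈b′ u)
  chosen-respʳ b≈b′ (right u)  = right (chosen-respʳ b≈b′ u)

  data SameOrder (a a′ b b′ : Carrier) : Set (c ⊔ ℓ₁ ⊔ ℓ₂) where
    less    : a < a′ → b < b′ → SameOrder a a′ b b′
    equal   : a ≈ a′ → b ≈ b′ → SameOrder a a′ b b′
    greater : a′ < a → b′ < b → SameOrder a a′ b b′

  -- Where the paths to the two pairs part, the points of the node separate the pairs in the same
  -- direction on both sides, or belong to one of them.
  same-order : Convex I → Convex J → {t : Position k I J} → ∀ {a a′ b b′} →
    Chosen a b t → Chosen a′ b′ t → SameOrder a a′ b b′
  same-order convI convJ (here p q) (here p′ q′) =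
    equal (Eq.trans p (Eq.sym p′)) (Eq.trans q (Eq.sym q′))
  same-order convI convJ (here p q) (left v)
    with chosen∈ (↓-convex convI) (↓-convex convJ) v
  ... | (_ , a′<x) , (_ , b′<y) =
    greater (<-respʳ-≈ (Eq.sym p) a′<x) (<-respʳ-≈ (Eq.sym q) b′<y)
  same-order convI convJ (here p q) (right v)
    with chosen∈ (↑-convex convI) (↑-convex convJ) v
  ... | (_ , x<a′) , (_ , y<b′) =
    less (<-respˡ-≈ (Eq.sym p) x<a′) (<-respˡ-≈ (Eq.sym q) y<b′)
  same-order convI convJ (left u) (here p q)
    with chosen∈ (↓-convex convI) (↓-convex convJ) u
  ... | (_ , a<x) , (_ , b<y) =
    less (<-respʳ-≈ (Eq.sym p) a<x) (<-respʳ-≈ (Eq.sym q) b<y)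
  same-order convI convJ (right u) (here p q)
    with chosen∈ (↑-convex convI) (↑-convex convJ) u
  ... | (_ , x<a) , (_ , y<b) =
    greater (<-respˡ-≈ (Eq.sym p) x<a) (<-respˡ-≈ (Eq.sym q) y<b)
  same-order convI convJ (left u) (left v) = same-order (↓-convex convI) (↓-convex convJ) u v
  same-order convI convJ (right u) (right v) = same-order (↑-convex convI) (↑-convex convJ) u v
  same-order convI convJ (left u) (right v)
    with chosen∈ (↓-convex convI) (↓-convex convJ) u | chosen∈ (↑-convex convI) (↑-convex convJ) v
  ... | (_ , a<x) , (_ , b<y) | (_ , x<a′) , (_ , y<b′) = less (trans a<x x<a′) (trans b<y y<b′)
  same-order convI convJ (right u) (left v)
    with chosen∈ (↑-convex convI) (↑-convex convJ) u | chosen∈ (↓-convex convI) (↓-convex convJ) v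
  ... | (_ , x<a) , (_ , y<b) | (_ , a′<x) , (_ , b′<y) = greater (trans a′<x x<a) (trans b′<y y<b)

  mirror : Position k I J → Position k J I
  mirror (gap I≋J)        = gap (swap I≋J)
  mirror (node Ix Jy s t) = node Jy Ix (mirror s) (mirror t)

  chosen-mirror : {t : Position k I J} → Chosen a b t → Chosen b a (mirror t)
  chosen-mirror (here p q) = here q p
  chosen-mirror (left u)   = left (chosen-mirror u)
  chosen-mirror (right u)  = right (chosen-mirror u)

  ≋-shrink : I ≋[ size (suc k) ] J → I ≋[ size k ] J
  ≋-shrink (I≲J , J≲I) = ≲-weaken (m≤m+n _ _) I≲J , ≲-weaken (m≤m+n _ _) J≲I

  weaken : Position (suc k) I J → Position k I J
  weaken {k = k} (gap I≋J) = gap (≋-shrink {k = k} I≋J)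
  weaken (node Ix Jy s t) = node Ix Jy (weaken s) (weaken t)

  chosen-weaken : {t : Position (suc k) I J} → Chosen a b t → Chosen a b (weaken t)
  chosen-weaken (here p q) = here p q
  chosen-weaken (left u)   = left (chosen-weaken u)
  chosen-weaken (right u)  = right (chosen-weaken u)

  -- Searches the tree for x. A point already at a node is answered by its partner; a gap is split
  -- by `answer`, and all other gaps merely drop to `size k`.
  respond : Convex I → Convex J → (t : Position (suc k) I J) → I x →
    ∃[ y ] Σ[ t′ ∈ Position k I J ] (Chosen x y t′ × (∀ {a b} → Chosen a b t → Chosen a b t′))
  respond {k = k} convI convJ (gap I≋J) Ix with answer convI convJ I≋J Ix
  ... | y , Jy , ans with split convI convJ I≋J Ix Jy (1≤size k) ans
  ...   | lo , hi = y , node Ix Jy (gap lo) (gap hi) , here Eq.refl Eq.refl , λ ()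
  respond {x = z} convI convJ (node {x = x} Ix Jy s t) Iz with compare z x
  ... | tri≈ _ z≈x _ = _ , weaken (node Ix Jy s t) , here z≈x Eq.refl , chosen-weaken
  ... | tri< z<x _ _ with respond (↓-convex convI) (↓-convex convJ) s (Iz , z<x)
  ...   | w , s′ , new , old = w , node Ix Jy s′ (weaken t) , left new , λ where
    (here p q) → here p q
    (left u)   → left (old u)
    (right u)  → right (chosen-weaken u)
  respond convI convJ (node Ix Jy s t) Iz | tri> _ _ x<z
    with respond (↑-convex convI) (↑-convex convJ) t (Iz , x<z)
  ... | w , t′ , new , old = w , node Ix Jy (weaken s) t′ , right new , λ where
    (here p q) → here p q
    (left u)   → left (chosen-weaken u)
    (right u)  → right (old u)

  -- Equivalence of tuples and preservation of formulas

  Whole : Subset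
  Whole _ = ⊤

  whole-convex : Convex Whole
  whole-convex _ _ _ _ = _

  record _∼[_]_ (ρ : Vec Carrier n) (k : ℕ) (σ : Vec Carrier n) : Set (c ⊔ ℓ₁ ⊔ ℓ₂) where
    constructor via
    field
      position : Position k Whole Whole
      chosen   : ∀ i → Chosen (lookup ρ i) (lookup σ i) position

  ∼-sym : {ρ σ : Vec Carrier n} → ρ ∼[ k ] σ → σ ∼[ k ] ρ
  ∼-sym (via t chosen) = via (mirror t) λ i → chosen-mirror (chosen i)

  ∼-extend : {ρ σ : Vec Carrier n} → ρ ∼[ suc k ] σ → ∀ x → ∃[ y ] (x ∷ ρ) ∼[ k ] (y ∷ σ)
  ∼-extend (via t chosen) x with respond {x = x} whole-convex whole-convex t _
  ... | y , t′ , new , old = y , via t′ λ where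
    zero    → new
    (suc i) → old (chosen i)

  rank : Formula n → ℕ
  rank (_ ≺̇ _)  = 0
  rank (_ ≈̇ _)  = 0
  rank ⊥̇        = 0
  rank (φ ∧̇ ψ)  = rank φ ⊔ℕ rank ψ
  rank (φ ∨̇ ψ)  = rank φ ⊔ℕ rank ψ
  rank (φ ⇒̇ ψ)  = rank φ ⊔ℕ rank ψ
  rank (∀̇ φ)    = suc (rank φ)
  rank (∃̇ φ)    = suc (rank φ)

  -- Each quantifier spends one round. Implications and universal quantifiers run the game
  -- backwards, from `σ` to `ρ`, which the symmetry of positions allows.
  transfer : (φ : Formula n) → rank φ ≤ k → {ρ σ : Vec Carrier n} →
    ρ ∼[ k ] σ → ρ ⊨ φ → σ ⊨ φ
  transfer (i ≺̇ j) _ (via t chosen) (lift ρi<ρj)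
    with same-order whole-convex whole-convex (chosen i) (chosen j)
  ... | less _ σi<σj     = lift σi<σj
  ... | equal ρi≈ρj _    = ⊥-elim (irrefl ρi≈ρj ρi<ρj)
  ... | greater ρj<ρi _  = ⊥-elim (asym ρi<ρj ρj<ρi)
  transfer (i ≈̇ j) _ (via t chosen) (lift ρi≈ρj)
    with same-order whole-convex whole-convex (chosen i) (chosen j)
  ... | less ρi<ρj _     = ⊥-elim (irrefl ρi≈ρj ρi<ρj)
  ... | equal _ σi≈σj    = lift σi≈σj
  ... | greater ρj<ρi _  = ⊥-elim (irrefl (Eq.sym ρi≈ρj) ρj<ρi)
  transfer (φ ∧̇ ψ) r e (p , q) =
    transfer φ (m⊔n≤o⇒m≤o _ _ r) e p , transfer ψ (m⊔n≤o⇒n≤o (rank φ) _ r) e q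
  transfer (φ ∨̇ ψ) r e (inj₁ p) = inj₁ (transfer φ (m⊔n≤o⇒m≤o _ _ r) e p)
  transfer (φ ∨̇ ψ) r e (inj₂ q) = inj₂ (transfer ψ (m⊔n≤o⇒n≤o (rank φ) _ r) e q)
  transfer (φ ⇒̇ ψ) r e f p = transfer ψ (m⊔n≤o⇒n≤o (rank φ) _ r) e
    (f (transfer φ (m⊔n≤o⇒m≤o _ _ r) (∼-sym e) p))
  transfer (∀̇ φ) (s≤s r) e f y with ∼-extend (∼-sym e) y
  ... | x , e′ = transfer φ r (∼-sym e′) (f x)
  transfer (∃̇ φ) (s≤s r) e (x , p) with ∼-extend e x
  ... | y , e′ = y , transfer φ r e′ p

  -- Positions fixing the parameters

  Fixes : Position k I I → Vec Carrier n → Set _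
  Fixes {I = I} t ρ = ∀ i → I (lookup ρ i) → Chosen (lookup ρ i) (lookup ρ i) t

  fixes-cons : {t : Position k I I} {ρ : Vec Carrier n} → ¬ I x → Fixes t ρ → Fixes t (x ∷ ρ)
  fixes-cons ¬Ix fixed zero    Ix = ⊥-elim (¬Ix Ix)
  fixes-cons ¬Ix fixed (suc i)    = fixed i

  fixes-node : {Ix : I x} {s : Position k (I ↓ x) (I ↓ x)} {t : Position k (I ↑ x) (I ↑ x)}
    {ρ : Vec Carrier n} → Fixes s ρ → Fixes t ρ → Fixes (node Ix Ix s t) (x ∷ ρ)
  fixes-node _ _ zero _ = here Eq.refl Eq.refl
  fixes-node {x = x} {ρ = ρ} fixedˡ fixedʳ (suc i) Ii with compare (lookup ρ i) x
  ... | tri< i<x _ _ = left (fixedˡ i (Ii , i<x))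
  ... | tri≈ _ i≈x _ = here i≈x i≈x
  ... | tri> _ _ x<i = right (fixedʳ i (Ii , x<i))

  -- Every gap is similar to itself for all k, so each entry may answer itself. Entries outside I
  -- are skipped, which lets the recursion pass the same `ρ` to both halves.
  diagonal : (I : Subset) (ρ : Vec Carrier n) → Σ[ t ∈ Position k I I ] Fixes t ρ
  diagonal I [] = gap (≲-refl , ≲-refl) , λ ()
  diagonal I (x ∷ ρ) with em {I x}
  diagonal I (x ∷ ρ) | no ¬Ix with diagonal I ρ
  ... | t , fixed = t , fixes-cons {t = t} {ρ} ¬Ix fixed
  diagonal I (x ∷ ρ) | yes Ix with diagonal (I ↓ x) ρ | diagonal (I ↑ x) ρ
  ... | s , fixedˡ | t , fixedʳ =
    node Ix Ix s t , fixes-node {s = s} {t} {ρ} fixedˡ fixedʳ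

  -- `Chosen` matches points up to `≈`, so in the position where each entry answers itself, y can
  -- replace x as the answer.
  ⊨-resp-≈ : (φ : Formula (suc n)) {ρ : Vec Carrier n} → x ≈ y → x ∷ ρ ⊨ φ → y ∷ ρ ⊨ φ
  ⊨-resp-≈ {x = x} φ {ρ} x≈y with diagonal {k = rank φ} Whole (x ∷ ρ)
  ... | t , fixed = transfer φ ≤-refl (via t λ where
    zero    → chosen-respʳ x≈y (fixed zero _)
    (suc i) → fixed (suc i) _)

  -- A cut without end points on either side

  module Gap (R : Subset) (final : ∀ {a b} → R a → a < b → R b)
             (no-first : ¬ HasFirst R) (no-last : ¬ HasLast (λ x → ¬ R x)) where

    lower-next : ¬ R x → ∃[ y ] (¬ R y × x < y)
    lower-next {x} ¬Rx with em {∃[ y ] (¬ R y × x < y)}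
    ... | yes next = next
    ... | no ¬next = ⊥-elim (no-last (x , ¬Rx , λ ¬Ry x<y → ¬next (_ , ¬Ry , x<y)))

    upper-next : R x → ∃[ y ] (R y × y < x)
    upper-next {x} Rx with em {∃[ y ] (R y × y < x)}
    ... | yes next = next
    ... | no ¬next = ⊥-elim (no-first (x , Rx , λ Ry y<x → ¬next (_ , Ry , y<x)))

    -- Finality shows that y is not below any point z outside R; choosing z strictly above x also
    -- rules out x ≈ y.
    lower<upper : ¬ R x → R y → x < y
    lower<upper {x} {y} ¬Rx Ry with lower-next ¬Rx
    ... | z , ¬Rz , x<z = <-≮-trans x<z (λ y<z → ¬Rz (final Ry y<z))

    Straddles : Subset → Set _
    Straddles I = (∃[ x ] (I x × ¬ R x)) × (∃[ y ] (I y × R y))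

    -- By `lower-next` and convexity, the part of I outside R has no last element, so it has chains
    -- of any length; in one of m + 1 + m points the middle is deep.
    lower-deep : Convex I → Straddles I → ∀ m →
      ∃[ x ] (I x × ¬ R x × AtLeast (I ↓ x) m × AtLeast (I ↑ x) m)
    lower-deep {I} conv ((_ , Ix , ¬Rx) , (_ , Iy , Ry)) m
      with pick m (¬last⇒AtLeast {I = λ z → I z × ¬ R z} next (Ix , ¬Rx) (m + suc m))
      where
      next : ∀ {z} → I z × ¬ R z → ∃[ w ] ((I w × ¬ R w) × z < w)
      next (Iz , ¬Rz) with lower-next ¬Rz
      ... | w , ¬Rw , z<w = w , (conv Iz Iy (asym z<w) (asym (lower<upper ¬Rw Ry)) , ¬Rw) , z<w
    ... | x , (Ix , ¬Rx) , a , b = x , Ix , ¬Rx ,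
      mono (λ ((Iz , _) , z<x) → Iz , z<x) ≤-refl a ,
      mono (λ ((Iz , _) , x<z) → Iz , x<z) ≤-refl b

    upper-deep : Convex I → Straddles I → ∀ m →
      ∃[ y ] (I y × R y × AtLeast (I ↓ y) m × AtLeast (I ↑ y) m)
    upper-deep {I} conv ((_ , Ix , ¬Rx) , (_ , Iy , Ry)) m
      with pick m (reverse⁻¹ _
             (Op.¬last⇒AtLeast {I = λ z → I z × R z} next (Iy , Ry) (m + suc m)))
      where
      next : ∀ {z} → I z × R z → ∃[ w ] ((I w × R w) × w < z)
      next (Iz , Rz) with upper-next Rz
      ... | w , Rw , w<z = w , (conv Ix Iz (asym (lower<upper ¬Rx Rw)) (asym w<z) , Rw) , w<z
    ... | y , (Iy , Ry) , a , b = y , Iy , Ry ,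
      mono (λ ((Iz , _) , z<y) → Iz , z<y) ≤-refl a ,
      mono (λ ((Iz , _) , y<z) → Iz , y<z) ≤-refl b

    -- Parameters in I become nodes one by one: the recursion enters the half containing the cut,
    -- and the other half gets a diagonal position. Once none remain, a deep point below the cut is
    -- matched with a deep point above it.
    across : Convex I → Straddles I → (ρ : Vec Carrier n) →
      ∃[ x ] ∃[ y ] (¬ R x × R y × Σ[ t ∈ Position k I I ] (Chosen x y t × Fixes t ρ))
    across {k = k} conv str []
      with lower-deep conv str (size k) | upper-deep conv str (size k)
    ... | x , Ix , ¬Rx , a , b | y , Iy , Ry , d , e
      -- Both sets are I, so their end points agree trivially; the four counts hold because every
      -- side has `size k` points.
      with split conv conv (≲-refl {n = 0} , ≲-refl) Ix Iy (1≤size k)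
             ((counts-full d , counts-full a) , (counts-full e , counts-full b))
    ...   | lo , hi =
      x , y , ¬Rx , Ry , node Ix Iy (gap lo) (gap hi) , here Eq.refl Eq.refl , λ ()
    across {I = I} conv str (p ∷ ρ) with em {I p} | em {R p}
    ... | no ¬Ip | _ with across conv str ρ
    ...   | x , y , ¬Rx , Ry , t , new , fixed =
      x , y , ¬Rx , Ry , t , new , fixes-cons {t = t} {ρ} ¬Ip fixed
    -- The parameter p is lost from I ↑ p, so a further point q outside R shows that this half still
    -- straddles the cut.
    across {I = I} conv (_ , (v , Iv , Rv)) (p ∷ ρ) | yes Ip | no ¬Rp with lower-next ¬Rp
    ... | q , ¬Rq , p<q
      with diagonal (I ↓ p) ρ
         | across (↑-convex {x = p} conv)
             ((q , (conv Ip Iv (asym p<q) (asym (lower<upper ¬Rq Rv)) , p<q) , ¬Rq) ,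
              (v , (Iv , lower<upper ¬Rp Rv) , Rv)) ρ
    ...   | s , fixedˡ | x , y , ¬Rx , Ry , t , new , fixedʳ =
      x , y , ¬Rx , Ry , node Ip Ip s t , right new , fixes-node {s = s} {t} {ρ} fixedˡ fixedʳ
    across {I = I} conv ((u , Iu , ¬Ru) , _) (p ∷ ρ) | yes Ip | yes Rp with upper-next Rp
    ... | q , Rq , q<p
      with across (↓-convex {x = p} conv)
             ((u , (Iu , lower<upper ¬Ru Rp) , ¬Ru) ,
              (q , (conv Iu Ip (asym (lower<upper ¬Ru Rq)) (asym q<p) , q<p) , Rq)) ρ
         | diagonal (I ↑ p) ρ
    ...   | x , y , ¬Rx , Ry , s , new , fixedˡ | t , fixedʳ =
      x , y , ¬Rx , Ry , node Ip Ip s t , left new , fixes-node {s = s} {t} {ρ} fixedˡ fixedʳ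

    undefinable : ¬ R x → R y → (φ : Formula (suc n)) (ρ : Vec Carrier n) →
      (∀ {z} → R z → z ∷ ρ ⊨ φ) → ¬ (∀ {z} → z ∷ ρ ⊨ φ → R z)
    undefinable ¬Rx Ry φ ρ R⇒φ φ⇒R
      with across {k = rank φ} whole-convex ((_ , _ , ¬Rx) , (_ , _ , Ry)) ρ
    ... | x , y , ¬Rx , Ry , t , new , old =
      ¬Rx (φ⇒R (transfer φ ≤-refl (∼-sym (via t λ where
        zero    → new
        (suc i) → old i _)) (R⇒φ Ry)))

-- End points of definable final segments in dense or discrete orders

dense⊎discrete⇒homogeneous : ∀ {c ℓ₁ ℓ₂} (em : ExcludedMiddle (c ⊔ ℓ₁ ⊔ ℓ₂))
  (Γ : StrictTotalOrder c ℓ₁ ℓ₂) → Ordered.Dense Γ ⊎ Ordered.Discrete Γ →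
  Counting.Homogeneous em Γ
-- A dense order has no adjacent pair, so the condition holds vacuously.
dense⊎discrete⇒homogeneous em Γ (inj₁ dense) {a} {b} (a<b , adj) _ =
  ⊥-elim (dense a (b , a<b , λ (_ , a<x , x<b) → adj a<x x<b))
dense⊎discrete⇒homogeneous em Γ (inj₂ discrete) _ c<d with discrete c<d
... | (s , c<s , ¬s) , (p , p<d , ¬p) =
  (s , c<s , λ c<x x<s → ¬s (_ , c<x , x<s)) , (p , p<d , λ p<x x<d → ¬p (_ , p<x , x<d))

lemma6p2 : ∀ {c ℓ₁ ℓ₂ ℓ : Level} → ExcludedMiddle (c ⊔ ℓ₁ ⊔ ℓ₂) →
    (Γ : StrictTotalOrder c ℓ₁ ℓ₂) →
    let open StrictTotalOrder Γ using (Carrier)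
        open Ordered Γ in
    (Δ : Pred Carrier ℓ) →
    Satisfiable Δ → Δ ⊂ U → Definable Δ → FinalSegment Δ →
    Dense ⊎ Discrete →
    ∃[ γ ] (Δ ≐ γ ₋ ⊎ Δ ≐ γ ₊)
lemma6p2 {c} {ℓ₁} {ℓ₂} em Γ Δ (_ , Δd) (_ , U⊈Δ) (n , φ , ρ , def) final dd =
  by-cases
  where
  open StrictTotalOrder Γ using (Carrier; _<_; compare; module Eq)
  open Ordered Γ
  open Counting em Γ using (Subset; HasFirst; HasLast)
  open Game em Γ (dense⊎discrete⇒homogeneous em Γ dd)

  -- The truth set of `φ` stands in for Δ, whose level ℓ is arbitrary, so that excluded middle
  -- applies to it.
  R : Subset
  R x = x ∷ ρ ⊨ φ

  Δ⇒R : ∀ {x} → Δ x → R x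
  Δ⇒R = Equivalence.to (def _)

  R⇒Δ : ∀ {x} → R x → Δ x
  R⇒Δ = Equivalence.from (def _)

  finalR : ∀ {a b} → R a → a < b → R b
  finalR Ra a<b = Δ⇒R (final (R⇒Δ Ra) a<b)

  by-cases : ∃[ γ ] (Δ ≐ γ ₋ ⊎ Δ ≐ γ ₊)
  -- Properness is the negation of U ⊆ Δ, so excluded middle has to supply a point outside R.
  by-cases with em {HasFirst R} | em {HasLast (λ x → ¬ R x)} | em {∃[ x ] ¬ R x}
  ... | yes (γ , Rγ , least) | _ | _ = γ , inj₁ (to , from)
    where
    to : ∀ {x} → Δ x → (γ ₋) x
    to {x} Δx with compare γ x
    ... | tri< γ<x _ _ = inj₁ γ<x
    ... | tri≈ _ γ≈x _ = inj₂ γ≈x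
    ... | tri> _ _ x<γ = ⊥-elim (least (Δ⇒R Δx) x<γ)
    from : ∀ {x} → (γ ₋) x → Δ x
    from (inj₁ γ<x) = R⇒Δ (finalR Rγ γ<x)
    from (inj₂ γ≈x) = R⇒Δ (⊨-resp-≈ φ γ≈x Rγ)
  ... | no _ | yes (γ , ¬Rγ , greatest) | _ = γ , inj₂ (to , from)
    where
    to : ∀ {x} → Δ x → γ < x
    to {x} Δx with compare γ x
    ... | tri< γ<x _ _ = γ<x
    ... | tri≈ _ γ≈x _ = ⊥-elim (¬Rγ (⊨-resp-≈ φ (Eq.sym γ≈x) (Δ⇒R Δx)))
    ... | tri> _ _ x<γ = ⊥-elim (¬Rγ (finalR (Δ⇒R Δx) x<γ))
    from : ∀ {x} → γ < x → Δ x
    from {x} γ<x with em {R x}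
    ... | yes Rx = R⇒Δ Rx
    ... | no ¬Rx = ⊥-elim (greatest ¬Rx γ<x)
  ... | no no-first | no no-last | yes (x , ¬Rx) =
    ⊥-elim (Gap.undefinable R finalR no-first no-last ¬Rx (Δ⇒R Δd) φ ρ (λ Rz → Rz) (λ p → p))
  ... | no _ | no _ | no ¬¬R = ⊥-elim (U⊈Δ U⊆Δ)
    where
    U⊆Δ : U ⊆ Δ
    U⊆Δ {x} _ with em {R x}
    ... | yes Rx = R⇒Δ Rx
    ... | no ¬Rx = ⊥-elim (¬¬R (x , ¬Rx))
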